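{- Let $s\ge1$ and $v\ge 2$ be integers. If there exists an orthogonal array OA$(s,2s,v)$, then there exists a $(t_i,t_o,s,v)$-AONT for all integers $t_i,t_o$ with $1\le t_i\le t_o\le s$.
   Context: An $(N,k,v)$-array is an $N\times k$ array with entries from an alphabet $\Gamma$ of size $v$. For a set $D$ of columns, the array is unbiased with respect to $D$ if the rows of the subarray consisting of the columns in $D$ contain every $|D|$-tuple over $\Gamma$ exactly $N/v^{|D|}$ times. An orthogonal array OA$(t,k,v)$ is a $(v^t,k,v)$-array that is unbiased with respect to every set of $t$ columns. For integers $1\le t_i\le t_o\le s$, a $(t_i,t_o,s,v)$-all-or-nothing transform (AONT) is a $(v^s,2s,v)$-array with columns labelled $1,\dots,2s$ that is unbiased with respect to $\{1,\dots,s\}$, with respect to $\{s+1,\dots,2s\}$, and with respect to $I\cup J$ for every $I\subseteq\{1,\dots,s\}$ with $|I|=t_i$ and every $J\subseteq\{s+1,\dots,2s\}$ with $|J|=s-t_o$. -}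

module Defs where

open import Data.Fin.Base using (Fin)
open import Data.Fin.Properties using (_≟_)
open import Data.Fin.Subset using (Subset; inside; outside; _⊆_; _∪_; ∣_∣; ⊤; ⊥)
open import Data.Nat.Base using (ℕ; _*_; _^_; _∸_)
open import Data.Vec.Base using (Vec; []; _∷_; _++_; count; map)
open import Data.Vec.Properties using (≡-dec)
open import Relation.Binary.PropositionalEquality using (_≡_)

-- An (N,k,v)-array as its vector of N rows, over the alphabet Γ = Fin v.
Array : ℕ → ℕ → ℕ → Set
Array N k v = Vec (Vec (Fin v) k) N

restrict : ∀ {A : Set} {k} (D : Subset k) → Vec A k → Vec A ∣ D ∣
restrict []            []       = []
restrict (inside  ∷ D) (x ∷ xs) = x ∷ restrict D xs
restrict (outside ∷ D) (x ∷ xs) = restrict D xs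

subarray : ∀ {N k v} (D : Subset k) → Array N k v → Array N ∣ D ∣ v
subarray D = map (restrict D)

multiplicity : ∀ {N k v} → Vec (Fin v) k → Array N k v → ℕ
multiplicity x = count (λ row → ≡-dec _≟_ row x)

-- "Exactly N / v^|D| times" with exact (not floor) division, hence the
-- denominator is cleared.
Unbiased : ∀ {N k v} → Array N k v → Subset k → Set
Unbiased {N} {k} {v} A D =
  (x : Vec (Fin v) ∣ D ∣) → multiplicity x (subarray D A) * v ^ ∣ D ∣ ≡ N

IsOA : (t k v : ℕ) → Array (v ^ t) k v → Set
IsOA t k v A = (D : Subset k) → ∣ D ∣ ≡ t → Unbiased A D

-- The columns {1,…,s} and {s+1,…,2s}; 2 * s unfolds to s + 1 * s.
firstColumns lastColumns : (s : ℕ) → Subset (2 * s)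
firstColumns s = ⊤ {s} ++ ⊥ {1 * s}
lastColumns  s = ⊥ {s} ++ ⊤ {1 * s}

-- The parameters are meant to satisfy 1 ≤ tᵢ ≤ tₒ ≤ s, so s ∸ tₒ is true
-- subtraction.
record IsAONT (tᵢ tₒ s v : ℕ) (A : Array (v ^ s) (2 * s) v) : Set where
  field
    unbiased-first : Unbiased A (firstColumns s)
    unbiased-last  : Unbiased A (lastColumns s)
    unbiased-mixed : (I J : Subset (2 * s)) →
                     I ⊆ firstColumns s → ∣ I ∣ ≡ tᵢ →
                     J ⊆ lastColumns s → ∣ J ∣ ≡ s ∸ tₒ →
                     Unbiased A (I ∪ J)

{-# OPTIONS --safe #-}
module Submission where

-- An orthogonal array of strength s is itself the required transform. If an
-- array is unbiased for D ∪ {i} with i ∉ D, then it is unbiased for D: a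
-- |D|-tuple occurs as often as its v extensions by an entry in column i do
-- together. Hence the array is unbiased for every set of at most s columns, and
-- |I ∪ J| ≤ tᵢ + (s − tₒ) ≤ s.

open import Defs
import Algebra.Properties.Semiring.Sum
open import Data.Bool.Base using (Bool; true; false; _∧_; if_then_else_)
open import Data.Fin.Base using (Fin; zero; suc)
open import Data.Fin.Properties using (_≟_)
open import Data.Fin.Subset using (Subset; inside; outside; _∪_; ∣_∣; ⊤; ⊥)
open import Data.Fin.Subset.Properties using (∣⊥∣≡0; ∣⊤∣≡n)
open import Data.Nat.Base using (ℕ; zero; suc; _+_; _≤_; _<_; _≤‴_; ≤‴-reflexive; ≤‴-step; s≤s; s≤s⁻¹; z≤n; _*_; _^_; _∸_; NonZero; >-nonZero)
open import Data.Nat.Properties using (+-*-semiring; +-identityʳ; *-comm; *-assoc; *-cancelʳ-≡; ≤⇒≤‴; ≤‴⇒≤; ≤-trans; ≤-reflexive; m≤m+n; n≤1+n; +-suc; +-monoˡ-≤; m+[n∸m]≡n; module ≤-Reasoning)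
open import Data.Product.Base using (Σ; _×_; _,_; ∃)
open import Data.Vec.Base using (Vec; []; _∷_; _++_)
open import Data.Vec.Properties using (≡-dec; ∷-injective)
open import Function.Bundles using (mk⇔)
open import Relation.Binary.PropositionalEquality using (_≡_; refl; sym; trans; cong; cong₂; module ≡-Reasoning)
open import Relation.Nullary.Decidable using (does; does-⇔; _×-dec_)

open Algebra.Properties.Semiring.Sum +-*-semiring using (sum-syntax; sum-cong-≗; sum-replicate-zero; ∑-distrib-+; *-distribʳ-sum)

private
  variable
    k n v N : ℕ
    b : Bool
    A : Set
    D E : Subset k

infix 4 _⋖_

-- The covering relation of the subset lattice. In this inductive form `∣ D ∣` and `∣ E ∣` compute
-- along the derivation, so tuples of these lengths need no transport, and the derivation itself
-- records the position of the added column.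
data _⋖_ : Subset k → Subset k → Set where
  here  : outside ∷ D ⋖ inside ∷ D
  there : D ⋖ E → b ∷ D ⋖ b ∷ E

⋖-size : D ⋖ E → ∣ E ∣ ≡ suc ∣ D ∣
⋖-size here                  = refl
⋖-size (there {b = true}  p) = cong suc (⋖-size p)
⋖-size (there {b = false} p) = ⋖-size p

⋖-exists : (D : Subset k) → ∣ D ∣ < k → ∃ λ E → D ⋖ E
⋖-exists (outside ∷ D) _    = inside ∷ D , here
⋖-exists (inside  ∷ D) D<k with ⋖-exists D (s≤s⁻¹ D<k)
... | E , p = inside ∷ E , there p

entry : {D E : Subset k} → D ⋖ E → Vec A k → A
entry here      (x ∷ _)  = x
entry (there p) (_ ∷ xs) = entry p xs

insert : D ⋖ E → A → Vec A ∣ D ∣ → Vec A ∣ E ∣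
insert here                  a xs       = a ∷ xs
insert (there {b = true}  p) a (x ∷ xs) = x ∷ insert p a xs
insert (there {b = false} p) a xs       = insert p a xs

restrict-insert : {D E : Subset k} (p : D ⋖ E) (xs : Vec A k) →
  restrict E xs ≡ insert p (entry p xs) (restrict D xs)
restrict-insert here                  (x ∷ xs) = refl
restrict-insert (there {b = true}  p) (x ∷ xs) = cong (x ∷_) (restrict-insert p xs)
restrict-insert (there {b = false} p) (x ∷ xs) = restrict-insert p xs

insert-injective : (p : D ⋖ E) {a c : A} {xs ys : Vec A ∣ D ∣} →
  insert p a xs ≡ insert p c ys → a ≡ c × xs ≡ ys
insert-injective here eq = ∷-injective eq
insert-injective (there {b = true} p) {xs = _ ∷ _} {_ ∷ _} eq
  with x≡y , eq′ ← ∷-injective eq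
  with a≡c , xs≡ys ← insert-injective p eq′ = a≡c , cong₂ _∷_ x≡y xs≡ys
insert-injective (there {b = false} p) eq = insert-injective p eq

indicator : Bool → ℕ
indicator b = if b then 1 else 0

sum-const : ∀ n c → ∑[ i < n ] c ≡ n * c
sum-const zero    c = refl
sum-const (suc n) c = cong (c +_) (sum-const n c)

sum-indicator-≟ : (i : Fin n) → ∑[ j < n ] indicator (does (i ≟ j)) ≡ 1
sum-indicator-≟ {suc n} zero    = cong suc (sum-replicate-zero n)
-- The leading term computes to 0 and `does (suc i ≟ suc j)` to `does (i ≟ j)`, so the induction
-- hypothesis fits as it stands.
sum-indicator-≟ {suc n} (suc i) = sum-indicator-≟ i

indicator-∧ : ∀ b c → indicator (b ∧ c) ≡ indicator b * indicator c
indicator-∧ true  c = sym (+-identityʳ (indicator c))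
indicator-∧ false c = refl

-- Turns the case split inside `count` into an addition, so that multiplicities can be compared row
-- by row.
multiplicity-∷ : (x y : Vec (Fin v) k) (R : Array N k v) →
  multiplicity x (y ∷ R) ≡ indicator (does (≡-dec _≟_ y x)) + multiplicity x R
multiplicity-∷ x y R with does (≡-dec _≟_ y x)
... | true  = refl
... | false = refl

-- Since insertion is injective in both arguments, only the term `a = c` can be nonzero, and that
-- term tests whether `y` equals `x`.
indicator-insert : {D E : Subset k} (p : D ⋖ E) (x y : Vec (Fin v) ∣ D ∣) (c : Fin v) →
  indicator (does (≡-dec _≟_ y x)) ≡
  ∑[ a < v ] indicator (does (≡-dec _≟_ (insert p c y) (insert p a x)))
indicator-insert {v = v} p x y c = begin
  e                                              ≡⟨ sym (+-identityʳ e) ⟩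
  1 * e                                          ≡⟨ cong (_* e) (sym (sum-indicator-≟ c)) ⟩
  ∑[ a < v ] indicator (does (c ≟ a)) * e        ≡⟨ *-distribʳ-sum e (λ a → indicator (does (c ≟ a))) ⟩
  ∑[ a < v ] (indicator (does (c ≟ a)) * e)      ≡⟨ sum-cong-≗ (λ a → sym (split a)) ⟩
  ∑[ a < v ] indicator (does (≡-dec _≟_ (insert p c y) (insert p a x))) ∎
  where
  open ≡-Reasoning
  e = indicator (does (≡-dec _≟_ y x))
  split : ∀ a → indicator (does (≡-dec _≟_ (insert p c y) (insert p a x))) ≡
                indicator (does (c ≟ a)) * e
  split a = trans
    -- The decision for a pair made by `×-dec` computes to the conjunction of the two decisions,
    -- which `indicator-∧` then splits into a product.
    (cong indicator (does-⇔
      (mk⇔ (insert-injective p) (λ (c≡a , y≡x) → cong₂ (insert p) c≡a y≡x))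
      (≡-dec _≟_ (insert p c y) (insert p a x))
      ((c ≟ a) ×-dec ≡-dec _≟_ y x)))
    (indicator-∧ (does (c ≟ a)) _)

-- Each row that shows `x` on `D` shows exactly one extension of `x` on `E`; the induction adds up
-- these contributions over the rows.
multiplicity-insert : {D E : Subset k} (p : D ⋖ E) (R : Array N k v) (x : Vec (Fin v) ∣ D ∣) →
  multiplicity x (subarray D R) ≡ ∑[ a < v ] multiplicity (insert p a x) (subarray E R)
multiplicity-insert {v = v} p [] x = sym (sum-replicate-zero v)
multiplicity-insert {v = v} {D = D} {E} p (r ∷ R) x = begin
  multiplicity x (subarray D (r ∷ R))
    ≡⟨ multiplicity-∷ x (restrict D r) (subarray D R) ⟩
  indicator (does (≡-dec _≟_ (restrict D r) x)) + multiplicity x (subarray D R)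
    -- The inserted value is arbitrary in `indicator-insert`; the row's own entry in the added
    -- column is chosen so that `restrict-insert` can recognise `restrict E r`.
    ≡⟨ cong₂ _+_ (indicator-insert p x (restrict D r) (entry p r)) (multiplicity-insert p R x) ⟩
  ∑[ a < v ] hit (insert p (entry p r) (restrict D r)) a + ∑[ a < v ] rest a
    ≡⟨ cong (λ y → ∑[ a < v ] hit y a + ∑[ a < v ] rest a) (sym (restrict-insert p r)) ⟩
  ∑[ a < v ] hit (restrict E r) a + ∑[ a < v ] rest a
    ≡⟨ sym (∑-distrib-+ (hit (restrict E r)) rest) ⟩
  ∑[ a < v ] (hit (restrict E r) a + rest a)
    ≡⟨ sum-cong-≗ (λ a → sym (multiplicity-∷ (insert p a x) (restrict E r) (subarray E R))) ⟩
  ∑[ a < v ] multiplicity (insert p a x) (subarray E (r ∷ R)) ∎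
  where
  open ≡-Reasoning
  hit : Vec (Fin v) ∣ E ∣ → Fin v → ℕ
  hit y a = indicator (does (≡-dec _≟_ y (insert p a x)))
  rest : Fin v → ℕ
  rest a = multiplicity (insert p a x) (subarray E R)

-- With the denominator cleared, an extra factor `v` raises `v ^ ∣ D ∣` to `v ^ ∣ E ∣`. Each of the
-- `v` extensions then contributes `N`, and the factor is cancelled because `v` is nonzero.
unbiased-⋖ : .{{_ : NonZero v}} {D E : Subset k} (R : Array N k v) →
  D ⋖ E → Unbiased R E → Unbiased R D
unbiased-⋖ {v = v} {N = N} {D} {E} R p unbiased x = *-cancelʳ-≡ _ _ v (begin
  multiplicity x (subarray D R) * v ^ ∣ D ∣ * v      ≡⟨ *-assoc (multiplicity x (subarray D R)) _ v ⟩
  multiplicity x (subarray D R) * (v ^ ∣ D ∣ * v)    ≡⟨ cong₂ _*_ (multiplicity-insert p R x) v^E ⟩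
  ∑[ a < v ] m a * v ^ ∣ E ∣                         ≡⟨ *-distribʳ-sum (v ^ ∣ E ∣) m ⟩
  ∑[ a < v ] (m a * v ^ ∣ E ∣)                       ≡⟨ sum-cong-≗ (λ a → unbiased (insert p a x)) ⟩
  ∑[ a < v ] N                                       ≡⟨ sum-const v N ⟩
  v * N                                              ≡⟨ *-comm v N ⟩
  N * v                                              ∎)
  where
  open ≡-Reasoning
  m : Fin v → ℕ
  m a = multiplicity (insert p a x) (subarray E R)
  v^E : v ^ ∣ D ∣ * v ≡ v ^ ∣ E ∣
  v^E = trans (*-comm (v ^ ∣ D ∣) v) (cong (v ^_) (sym (⋖-size p)))

OA⇒unbiased-≤ : ∀ {t} .{{_ : NonZero v}} (R : Array (v ^ t) k v) → IsOA t k v R → t ≤ k →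
  (D : Subset k) → ∣ D ∣ ≤ t → Unbiased R D
OA⇒unbiased-≤ {v = v} {k} {t} R oa t≤k D D≤t = go D refl (≤⇒≤‴ D≤t)
  where
  -- The induction is on the gap between `∣ D ∣` and `t`. With the size named `d`, the recursive
  -- call takes `∣ E ∣ ≡ suc ∣ D ∣` as an equation and `d<t` unchanged.
  go : ∀ {d} (D : Subset k) → ∣ D ∣ ≡ d → d ≤‴ t → Unbiased R D
  go D eq   (≤‴-reflexive d≡t) = oa D (trans eq d≡t)
  -- Here `∣ D ∣ < t ≤ k`, so some column lies outside `D` and can be added.
  go D refl (≤‴-step d<t) with E , p ← ⋖-exists D (≤-trans (≤‴⇒≤ d<t) t≤k) =
    unbiased-⋖ R p (go E (⋖-size p) d<t)

∣p∪q∣≤∣p∣+∣q∣ : (p q : Subset k) → ∣ p ∪ q ∣ ≤ ∣ p ∣ + ∣ q ∣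
∣p∪q∣≤∣p∣+∣q∣ []            []            = z≤n
∣p∪q∣≤∣p∣+∣q∣ (outside ∷ p) (outside ∷ q) = ∣p∪q∣≤∣p∣+∣q∣ p q
∣p∪q∣≤∣p∣+∣q∣ (outside ∷ p) (inside  ∷ q) =
  ≤-trans (s≤s (∣p∪q∣≤∣p∣+∣q∣ p q)) (≤-reflexive (sym (+-suc ∣ p ∣ ∣ q ∣)))
∣p∪q∣≤∣p∣+∣q∣ (inside  ∷ p) (outside ∷ q) = s≤s (∣p∪q∣≤∣p∣+∣q∣ p q)
∣p∪q∣≤∣p∣+∣q∣ (inside  ∷ p) (inside  ∷ q) =
  s≤s (≤-trans (∣p∪q∣≤∣p∣+∣q∣ p q) (≤-trans (n≤1+n _) (≤-reflexive (sym (+-suc ∣ p ∣ ∣ q ∣)))))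

∣p++q∣≡∣p∣+∣q∣ : (p : Subset k) (q : Subset n) → ∣ p ++ q ∣ ≡ ∣ p ∣ + ∣ q ∣
∣p++q∣≡∣p∣+∣q∣ []            q = refl
∣p++q∣≡∣p∣+∣q∣ (outside ∷ p) q = ∣p++q∣≡∣p∣+∣q∣ p q
∣p++q∣≡∣p∣+∣q∣ (inside  ∷ p) q = cong suc (∣p++q∣≡∣p∣+∣q∣ p q)

∣firstColumns∣ : ∀ s → ∣ firstColumns s ∣ ≡ s
∣firstColumns∣ s = trans (∣p++q∣≡∣p∣+∣q∣ (⊤ {s}) ⊥)
  (trans (cong₂ _+_ (∣⊤∣≡n s) (∣⊥∣≡0 (1 * s))) (+-identityʳ s))

∣lastColumns∣ : ∀ s → ∣ lastColumns s ∣ ≡ s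
∣lastColumns∣ s = trans (∣p++q∣≡∣p∣+∣q∣ (⊥ {s}) ⊤)
  (trans (cong₂ _+_ (∣⊥∣≡0 s) (∣⊤∣≡n (1 * s))) (+-identityʳ s))

mainTheorem2 : (s v : ℕ) → 1 ≤ s → 2 ≤ v →
    Σ (Array (v ^ s) (2 * s) v) (IsOA s (2 * s) v) →
    (tᵢ tₒ : ℕ) → 1 ≤ tᵢ → tᵢ ≤ tₒ → tₒ ≤ s →
    Σ (Array (v ^ s) (2 * s) v) (IsAONT tᵢ tₒ s v)
mainTheorem2 s v _ 2≤v (R , oa) tᵢ tₒ _ tᵢ≤tₒ tₒ≤s = R , record
  { unbiased-first = oa (firstColumns s) (∣firstColumns∣ s)
  ; unbiased-last  = oa (lastColumns s) (∣lastColumns∣ s)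
  ; unbiased-mixed = λ I J _ ∣I∣≡tᵢ _ ∣J∣≡s∸tₒ →
      -- `2 * s` unfolds to `s + 1 * s`, so `m≤m+n` gives the bound of the strength by the number of
      -- columns.
      OA⇒unbiased-≤ {{>-nonZero (≤-trans (n≤1+n 1) 2≤v)}} R oa (m≤m+n s (1 * s)) (I ∪ J)
        (begin
          ∣ I ∪ J ∣        ≤⟨ ∣p∪q∣≤∣p∣+∣q∣ I J ⟩
          ∣ I ∣ + ∣ J ∣    ≡⟨ cong₂ _+_ ∣I∣≡tᵢ ∣J∣≡s∸tₒ ⟩
          tᵢ + (s ∸ tₒ)    ≤⟨ +-monoˡ-≤ (s ∸ tₒ) tᵢ≤tₒ ⟩
          tₒ + (s ∸ tₒ)    ≡⟨ m+[n∸m]≡n tₒ≤s ⟩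
          s                ∎)
  }
  where open ≤-Reasoning
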